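{- Let $G^1=I^1+C^1$ be a connected $K_{1,4}$-free $3$-split graph, and let the terminal set be $R=I^1$. Then any minimum Steiner set $S$ of $G^1$ satisfies $|S|\geq |I^1|-4$.
   Context: Graphs are finite, simple, unweighted and connected. A split graph $G=I+C$ is a graph with $V(G)=I\cup C$ (disjoint union), where $I$ is an independent set and $C$ is a clique; $C$ is assumed to be a maximal clique of $G$. For $v\in C$, $N_G^I(v)=N_G(v)\cap I$, $d_G^I(v)=|N_G^I(v)|$, and $\Delta_G^I=\max\{d_G^I(v): v\in C\}$. A split graph $G$ is an $l$-split graph if $\Delta_G^I=l$. A graph is $K_{1,4}$-free if it has no induced star with $4$ leaves. For a terminal set $R\subseteq V(G)$, a Steiner set is a set $S\subseteq V(G)\setminus R$ such that $G[S\cup R]$ is connected; it is minimum if it has minimum cardinality among all Steiner sets. -}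

module Defs where

open import Data.Empty using (⊥)
open import Data.Fin using (Fin; zero; suc)
open import Data.Fin.Subset
  using (Subset; ∣_∣; _∈_; _⊆_; _∩_; _∪_; Empty; ⊤)
open import Data.Fin.Subset.Properties using (_∈?_)
open import Data.List using (map; filter; allFin)
open import Data.List.Extrema.Nat using (max)
open import Data.Nat using (ℕ; suc; _≤_)
open import Data.Product using (_×_; Σ-syntax)
open import Data.Unit using (tt) renaming (⊤ to Unit)
open import Data.Vec using (tabulate)
open import Function.Bundles using (_⇔_)
open import Function.Definitions using (Injective)
open import Level using (0ℓ)
open import Relation.Binary.Core using (Rel)
open import Relation.Binary.Construct.Closure.ReflexiveTransitive using (Star)
open import Relation.Binary.Definitions using (Decidable; Symmetric)
open import Relation.Binary.PropositionalEquality using (_≡_; _≢_)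
open import Relation.Nullary using (¬_; yes; no; does)

-- Adjacency is decidable so that neighbourhoods can be counted.

record Graph (n : ℕ) : Set₁ where
  field
    Adj   : Rel (Fin n) 0ℓ
    adj?  : Decidable Adj
    sym   : Symmetric Adj
    irrfl : ∀ {v} → ¬ Adj v v

open Graph

module _ {n : ℕ} (G : Graph n) where

  N : Fin n → Subset n
  N v = tabulate (λ u → does (adj? G v u))

  -- The edge relation of G[X]. It lives on all of Fin n, but a nonempty walk
  -- along it never leaves X.
  AdjIn : Subset n → Rel (Fin n) 0ℓ
  AdjIn X u v = u ∈ X × v ∈ X × Adj G u v

  ConnectedOn : Subset n → Set
  ConnectedOn X = ∀ u v → u ∈ X → v ∈ X → Star (AdjIn X) u v

  Connected : Set
  Connected = ConnectedOn ⊤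

  Independent : Subset n → Set
  Independent X = ∀ u v → u ∈ X → v ∈ X → ¬ Adj G u v

  Clique : Subset n → Set
  Clique X = ∀ u v → u ∈ X → v ∈ X → u ≢ v → Adj G u v

  -- Maximal under inclusion, not necessarily of maximum size.
  MaximalClique : Subset n → Set
  MaximalClique X = Clique X × (∀ Y → Clique Y → X ⊆ Y → Y ≡ X)

  record IsSplit (I C : Subset n) : Set where
    field
      cover       : I ∪ C ≡ ⊤
      disjoint    : Empty (I ∩ C)
      independent : Independent I
      maxClique   : MaximalClique C

  dᴵ : Subset n → Fin n → ℕ
  dᴵ I v = ∣ N v ∩ I ∣

  -- The first argument of max is the value returned when C is empty.
  Δᴵ : Subset n → Subset n → ℕ
  Δᴵ I C = max 0 (map (dᴵ I) (filter (_∈? C) (allFin n)))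

  record IsLSplit (l : ℕ) (I C : Subset n) : Set where
    field
      isSplit : IsSplit I C
      Δᴵ≡l    : Δᴵ I C ≡ l

  record SteinerSet (R S : Subset n) : Set where
    field
      disjoint  : Empty (S ∩ R)
      connected : ConnectedOn (S ∪ R)

  record MinimumSteinerSet (R S : Subset n) : Set where
    field
      steiner : SteinerSet R S
      minimum : ∀ T → SteinerSet R T → ∣ S ∣ ≤ ∣ T ∣

InducedSubgraph : ∀ {m n} → Graph m → Graph n → Set
InducedSubgraph {m} {n} H G =
  Σ[ f ∈ (Fin m → Fin n) ]
    Injective _≡_ _≡_ f × (∀ u v → Adj H u v ⇔ Adj G (f u) (f v))

K₁,_ : (k : ℕ) → Graph (suc k)
K₁, k = record
  { Adj   = E
  ; adj?  = E?
  ; sym   = λ {u} {v} → E-sym u v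
  ; irrfl = λ {v} → E-irr v
  }
  where
  -- The vertex zero is the centre, the vertices suc i are the leaves.
  E : Rel (Fin (suc k)) 0ℓ
  E zero    (suc _) = Unit
  E (suc _) zero    = Unit
  E zero    zero    = ⊥
  E (suc _) (suc _) = ⊥

  E? : Decidable E
  E? zero    (suc _) = yes tt
  E? (suc _) zero    = yes tt
  E? zero    zero    = no λ ()
  E? (suc _) (suc _) = no λ ()

  E-sym : ∀ u v → E u v → E v u
  E-sym zero    (suc _) _ = tt
  E-sym (suc _) zero    _ = tt

  E-irr : ∀ v → ¬ E v v
  E-irr zero    ()
  E-irr (suc _) ()

_-free_ : ∀ {m n} → Graph m → Graph n → Set
H -free G = ¬ InducedSubgraph H G

{-# OPTIONS --safe #-}

-- Write M v for the I-neighbourhood of v ∈ C. A vertex with ∣M v∣ = 3 and a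
-- vertex u with M u disjoint from M v would span a K₁,₄, so M v meets every M u.
-- A Steiner set S lies in C and its M u cover I. Pick vertices of S greedily,
-- as long as some M u has two elements outside the union U of the sets already
-- picked; once none does, ∣I∣ ≤ ∣U∣ + #(vertices of S not picked). If some
-- v ∈ S has ∣M v∣ = 3, start with it: ∣U∣ + #(not picked) is then ∣S∣ + 2 and
-- grows by at most 1 per further pick, so it is enough to rule out a fourth pick.
-- Four picks would be a sunflower of triples with a one-element core a; since C is
-- maximal, some w ∈ C is not adjacent to a, and M w, having at most 3 elements,
-- cannot meet the four disjoint petals. If no v ∈ S has ∣M v∣ = 3, start with
-- U = M v for a v ∈ C outside S: nothing can be picked, and ∣I∣ ≤ 3 + ∣S∣.
module Submission where

open import Defs
open import Data.Empty using (⊥-elim)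
open import Data.Fin using (Fin; zero; suc; _≟_; inject≤)
open import Data.Fin.Properties using (any?; inject≤-injective; suc-injective)
open import Data.Fin.Subset
  using (Subset; ∣_∣; inside; outside; _∈_; _∉_; _∩_; _∪_; ∁; ⁅_⁆; _-_)
open import Data.Fin.Subset.Properties
  using (_∈?_; ∈⊤; x∈p∩q⁺; x∈p∩q⁻; x∈p∪q⁺; x∈p∪q⁻; p⊆p∪q; q⊆p∪q; p⊆q⇒∣p∣≤∣q∣;
         ∣p∣≤∣p∪q∣; x∈∁p⇒x∉p; x∈p∧x≢y⇒x∈p-y; x∈p⇒∣p-x∣<∣p∣; p─q⊆p;
         x∈⁅y⁆⇒x≡y; x∈⁅x⁆; nonempty?)
open import Data.List using (List; []; _∷_; length; map; filter; allFin)
open import Data.List.Extrema.Nat using (argmax-sel; xs≤max)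
open import Data.List.Membership.Propositional.Properties
  using (∈-map⁺; ∈-map⁻; ∈-filter⁺; ∈-filter⁻; ∈-allFin)
open import Data.List.Properties using (length-tabulate)
open import Data.List.Relation.Unary.All as All using (All; []; _∷_)
import Data.List.Relation.Unary.All.Properties as All
open import Data.List.Relation.Unary.AllPairs using ([]; _∷_)
open import Data.List.Relation.Unary.Unique.Propositional using (Unique)
open import Data.List.Relation.Unary.Unique.Propositional.Properties using (tabulate⁺)
open import Data.Nat using (ℕ; suc; _+_; _∸_; _≤_; _≥_; _≤?_; z≤n; s≤s; s≤s⁻¹)
open import Data.Nat.Properties
  using (≤-trans; ≤-reflexive; +-mono-≤; +-monoˡ-≤; +-comm; +-suc;
         m≤n⇒m≤1+n; m≤n+o⇒m∸n≤o; 1+n≰n; module ≤-Reasoning)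
open import Data.Product using (_×_; _,_; proj₁; proj₂; ∃-syntax; ∃₂)
open import Data.Sum using (_⊎_; inj₁; inj₂)
open import Data.Unit using (tt)
open import Data.Vec using ([]; _∷_; here; there)
open import Data.Vec.Properties using (lookup⇒[]=; []=⇒lookup; lookup∘tabulate)
open import Function using (_∘_; mk⇔)
open import Function.Definitions using (Injective)
open import Relation.Binary.Construct.Closure.ReflexiveTransitive using (Star; ε; _◅_)
open import Relation.Binary.PropositionalEquality
  using (_≡_; _≢_; refl; sym; trans; cong; subst; ≢-sym)
open import Relation.Nullary using (¬_; yes; no; contradiction)
open import Relation.Nullary.Decidable using (_×-dec_; dec-true; ¬?; decidable-stable)

private variable
  n k : ℕ

-- Cardinalities of subsets

∣p∪q∣≤∣p∩∁q∣+∣q∣ : (p q : Subset n) → ∣ p ∪ q ∣ ≤ ∣ p ∩ ∁ q ∣ + ∣ q ∣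
∣p∪q∣≤∣p∩∁q∣+∣q∣ [] [] = z≤n
∣p∪q∣≤∣p∩∁q∣+∣q∣ (inside  ∷ p) (outside ∷ q) = s≤s (∣p∪q∣≤∣p∩∁q∣+∣q∣ p q)
∣p∪q∣≤∣p∩∁q∣+∣q∣ (outside ∷ p) (outside ∷ q) = ∣p∪q∣≤∣p∩∁q∣+∣q∣ p q
∣p∪q∣≤∣p∩∁q∣+∣q∣ (inside  ∷ p) (inside  ∷ q) =
  ≤-trans (s≤s (∣p∪q∣≤∣p∩∁q∣+∣q∣ p q)) (≤-reflexive (sym (+-suc _ _)))
∣p∪q∣≤∣p∩∁q∣+∣q∣ (outside ∷ p) (inside  ∷ q) =
  ≤-trans (s≤s (∣p∪q∣≤∣p∩∁q∣+∣q∣ p q)) (≤-reflexive (sym (+-suc _ _)))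

unique⇒length≤∣p∣ : {xs : List (Fin n)} {p : Subset n} →
                    Unique xs → All (_∈ p) xs → length xs ≤ ∣ p ∣
unique⇒length≤∣p∣ [] [] = z≤n
unique⇒length≤∣p∣ (x∉xs ∷ uniq) (x∈p ∷ xs⊆p) = ≤-trans
  (s≤s (unique⇒length≤∣p∣ uniq
    (All.zipWith (λ (x≢y , y∈p) → x∈p∧x≢y⇒x∈p-y y∈p (≢-sym x≢y)) (x∉xs , xs⊆p))))
  (x∈p⇒∣p-x∣<∣p∣ x∈p)

injection⇒k≤∣p∣ : {p : Subset n} (f : Fin k → Fin n) →
                  Injective _≡_ _≡_ f → (∀ i → f i ∈ p) → k ≤ ∣ p ∣
injection⇒k≤∣p∣ f f-inj f∈p = subst (_≤ _) (length-tabulate f)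
  (unique⇒length≤∣p∣ (tabulate⁺ f-inj) (All.tabulate⁺ f∈p))

enum : (p : Subset n) → Fin ∣ p ∣ → Fin n
enum (inside  ∷ p) zero    = zero
enum (inside  ∷ p) (suc i) = suc (enum p i)
enum (outside ∷ p) i       = suc (enum p i)

enum-injective : (p : Subset n) → Injective _≡_ _≡_ (enum p)
enum-injective (inside  ∷ p) {zero}  {zero}  eq = refl
enum-injective (inside  ∷ p) {suc i} {suc j} eq =
  cong suc (enum-injective p (suc-injective eq))
enum-injective (outside ∷ p) eq = enum-injective p (suc-injective eq)

enum-∈ : (p : Subset n) (i : Fin ∣ p ∣) → enum p i ∈ p
enum-∈ (inside  ∷ p) zero    = here
enum-∈ (inside  ∷ p) (suc i) = there (enum-∈ p i)
enum-∈ (outside ∷ p) i       = there (enum-∈ p i)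

k≤∣p∣⇒injection : {p : Subset n} → k ≤ ∣ p ∣ →
                  ∃[ f ] Injective _≡_ _≡_ f × (∀ (i : Fin k) → f i ∈ p)
k≤∣p∣⇒injection {p = p} k≤ =
  (λ i → enum p (inject≤ i k≤)) ,
  (λ eq → inject≤-injective k≤ k≤ _ _ (enum-injective p eq)) ,
  (λ i → enum-∈ p (inject≤ i k≤))

Two : Subset n → Set
Two p = ∃₂ λ x y → x ≢ y × x ∈ p × y ∈ p

2≤∣p∣⇒Two : {p : Subset n} → 2 ≤ ∣ p ∣ → Two p
2≤∣p∣⇒Two 2≤ with k≤∣p∣⇒injection 2≤
... | f , f-inj , f∈ = f zero , f (suc zero) , 0≢1 ∘ f-inj , f∈ zero , f∈ (suc zero)
  where
  0≢1 : zero ≢ suc zero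
  0≢1 ()

-- Choosing a related `u` for each element of `p` is injective, because no `u` in `q` is related to
-- two elements of `p`.
matching⇒∣p∣≤∣q∣ : {p q : Subset n} (R : Fin n → Fin n → Set) →
                   (∀ {x} → x ∈ p → ∃[ u ] u ∈ q × R x u) →
                   (∀ {x y u} → x ∈ p → y ∈ p → u ∈ q → R x u → R y u → x ≡ y) →
                   ∣ p ∣ ≤ ∣ q ∣
matching⇒∣p∣≤∣q∣ {p = p} {q} R total unique = injection⇒k≤∣p∣ f f-inj (λ i → proj₁ (proj₂ (g i)))
  where
  g : ∀ i → ∃[ u ] u ∈ q × R (enum p i) u
  g i = total (enum-∈ p i)
  f : Fin ∣ p ∣ → Fin _
  f i = proj₁ (g i)
  f-inj : Injective _≡_ _≡_ f
  f-inj {i} {j} eq = enum-injective p (unique (enum-∈ p i) (enum-∈ p j)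
    (proj₁ (proj₂ (g i))) (proj₂ (proj₂ (g i)))
    (subst (R (enum p j)) (sym eq) (proj₂ (proj₂ (g j)))))

-- Neighbourhoods and stars

module _ {n : ℕ} (G : Graph n) where
  open Graph G renaming (sym to adj-sym)

  ∈N⁺ : ∀ {v x} → Adj v x → x ∈ N G v
  ∈N⁺ {v} {x} vx = lookup⇒[]= x _ (trans (lookup∘tabulate _ x) (dec-true (adj? v x) vx))

  ∈N⁻ : ∀ {v x} → x ∈ N G v → Adj v x
  ∈N⁻ {v} {x} x∈N with adj? v x | trans (sym (lookup∘tabulate _ x)) ([]=⇒lookup x∈N)
  ... | yes vx | _  = vx
  ... | no  _  | ()

  star⇒K₁ : (c : Fin n) (leaf : Fin k → Fin n) → Injective _≡_ _≡_ leaf →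
            (∀ i → Adj c (leaf i)) → (∀ i j → ¬ Adj (leaf i) (leaf j)) →
            InducedSubgraph (K₁, k) G
  star⇒K₁ {k} c leaf leaf-inj c~leaf leaf≁leaf = f , f-inj , f-adj
    where
    f : Fin (suc k) → Fin n
    f zero    = c
    f (suc i) = leaf i

    c≢leaf : ∀ i → c ≢ leaf i
    c≢leaf i eq = irrfl (subst (Adj c) (sym eq) (c~leaf i))

    f-inj : Injective _≡_ _≡_ f
    f-inj {zero}  {zero}  eq = refl
    f-inj {zero}  {suc j} eq = contradiction eq (c≢leaf j)
    f-inj {suc i} {zero}  eq = contradiction (sym eq) (c≢leaf i)
    f-inj {suc i} {suc j} eq = cong suc (leaf-inj eq)

    f-adj : ∀ u v → _
    f-adj zero    zero    = mk⇔ (λ ()) irrfl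
    f-adj zero    (suc j) = mk⇔ (λ _ → c~leaf j) (λ _ → tt)
    f-adj (suc i) zero    = mk⇔ (λ _ → adj-sym (c~leaf i)) (λ _ → tt)
    f-adj (suc i) (suc j) = mk⇔ (λ ()) (leaf≁leaf i j)

-- Split graphs

module _ {n : ℕ} (G : Graph n) (I C : Subset n) where
  open Graph G renaming (sym to adj-sym)

  M : Fin n → Subset n
  M v = N G v ∩ I

  Δᴵ-bound : ∀ {v} → v ∈ C → ∣ M v ∣ ≤ Δᴵ G I C
  Δᴵ-bound v∈C = All.lookup (xs≤max 0 _)
    (∈-map⁺ (dᴵ G I) (∈-filter⁺ (_∈? C) (∈-allFin _) v∈C))

  Δᴵ-attained : Δᴵ G I C ≡ suc k → ∃[ v ] v ∈ C × ∣ M v ∣ ≡ suc k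
  Δᴵ-attained Δ≡ with argmax-sel (λ d → d) 0 (map (dᴵ G I) (filter (_∈? C) (allFin n)))
  ... | inj₁ Δ≡0 = contradiction (trans (sym Δ≡) Δ≡0) λ ()
  ... | inj₂ Δ∈ with ∈-map⁻ (dᴵ G I) Δ∈
  ...   | v , v∈ , Δ≡d = v , proj₂ (∈-filter⁻ (_∈? C) {xs = allFin n} v∈) , trans (sym Δ≡d) Δ≡

  module _ (split : IsSplit G I C) where
    open IsSplit split

    I⇒∉C : ∀ {x} → x ∈ I → x ∉ C
    I⇒∉C x∈I x∈C = disjoint (_ , x∈p∩q⁺ (x∈I , x∈C))

    ∉I⇒C : ∀ {x} → x ∉ I → x ∈ C
    ∉I⇒C x∉I with x∈p∪q⁻ I C (subst (_ ∈_) (sym cover) ∈⊤)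
    ... | inj₁ x∈I = contradiction x∈I x∉I
    ... | inj₂ x∈C = x∈C

    -- If all of `C` were adjacent to `a`, then `C ∪ ⁅ a ⁆` would be a clique, hence equal to `C` by
    -- maximality, which puts `a` in both `I` and `C`.
    nonneighbour : ∀ {a} → a ∈ I → ∃[ w ] w ∈ C × ¬ Adj w a
    nonneighbour {a} a∈I with any? (λ w → w ∈? C ×-dec ¬? (adj? w a))
    ... | yes found = found
    ... | no  none  = contradiction (subst (a ∈_) C+a≡C (x∈p∪q⁺ (inj₂ (x∈⁅x⁆ a)))) (I⇒∉C a∈I)
      where
      ~a : ∀ {w} → w ∈ C → Adj w a
      ~a {w} w∈C = decidable-stable (adj? w a) (λ w≁a → none (w , w∈C , w≁a))

      clique : Clique G (C ∪ ⁅ a ⁆)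
      clique u v u∈ v∈ u≢v with x∈p∪q⁻ C ⁅ a ⁆ u∈ | x∈p∪q⁻ C ⁅ a ⁆ v∈
      ... | inj₁ u∈C | inj₁ v∈C = proj₁ maxClique u v u∈C v∈C u≢v
      ... | inj₁ u∈C | inj₂ v∈a rewrite x∈⁅y⁆⇒x≡y a v∈a = ~a u∈C
      ... | inj₂ u∈a | inj₁ v∈C rewrite x∈⁅y⁆⇒x≡y a u∈a = adj-sym (~a v∈C)
      ... | inj₂ u∈a | inj₂ v∈a =
        contradiction (trans (x∈⁅y⁆⇒x≡y a u∈a) (sym (x∈⁅y⁆⇒x≡y a v∈a))) u≢v

      C+a≡C : C ∪ ⁅ a ⁆ ≡ C
      C+a≡C = proj₂ maxClique _ clique (p⊆p∪q ⁅ a ⁆)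

    -- If `M v` and `M u` were disjoint, `u` and `k` elements of `M v` would be the leaves of an
    -- induced star centred at `v`.
    large-meets : ∀ {v u} → (K₁, suc k) -free G → v ∈ C → u ∈ C → k ≤ ∣ M v ∣ →
                  v ≢ u → ∃[ x ] x ∈ M v × x ∈ M u
    large-meets {k} {v} {u} free v∈C u∈C k≤ v≢u with nonempty? (M v ∩ M u)
    ... | yes (x , x∈) = x , x∈p∩q⁻ (M v) (M u) x∈
    ... | no  empty with k≤∣p∣⇒injection k≤
    ...   | f , f-inj , f∈M = ⊥-elim (free (star⇒K₁ G v leaf leaf-inj v~leaf leaf≁leaf))
      where
      leaf : Fin (suc k) → Fin n
      leaf zero    = u
      leaf (suc i) = f i

      f∈I : ∀ i → f i ∈ I
      f∈I i = proj₂ (x∈p∩q⁻ (N G v) I (f∈M i))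

      u≢f : ∀ i → u ≢ f i
      u≢f i eq = I⇒∉C (f∈I i) (subst (_∈ C) eq u∈C)

      u≁f : ∀ i → ¬ Adj u (f i)
      u≁f i u~f = empty (f i , x∈p∩q⁺ (f∈M i , x∈p∩q⁺ (∈N⁺ G u~f , f∈I i)))

      leaf-inj : Injective _≡_ _≡_ leaf
      leaf-inj {zero}  {zero}  eq = refl
      leaf-inj {zero}  {suc j} eq = contradiction eq (u≢f j)
      leaf-inj {suc i} {zero}  eq = contradiction (sym eq) (u≢f i)
      leaf-inj {suc i} {suc j} eq = cong suc (f-inj eq)

      v~leaf : ∀ i → Adj v (leaf i)
      v~leaf zero    = proj₁ maxClique v u v∈C u∈C v≢u
      v~leaf (suc i) = ∈N⁻ G (proj₁ (x∈p∩q⁻ (N G v) I (f∈M i)))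

      leaf≁leaf : ∀ i j → ¬ Adj (leaf i) (leaf j)
      leaf≁leaf zero    zero    = irrfl
      leaf≁leaf zero    (suc j) = u≁f j
      leaf≁leaf (suc i) zero    = u≁f i ∘ adj-sym
      leaf≁leaf (suc i) (suc j) = independent _ _ (f∈I i) (f∈I j)

    -- Steiner sets with terminal set `I`

    Steiner⊆C : ∀ {S u} → SteinerSet G I S → u ∈ S → u ∈ C
    Steiner⊆C steiner u∈S =
      ∉I⇒C (λ u∈I → SteinerSet.disjoint steiner (_ , x∈p∩q⁺ (u∈S , u∈I)))

    -- The bound on `∣ I ∣` provides a second terminal. The walk to it from `x` is nonempty, and its
    -- first step enters `S` because `I` is independent.
    Steiner-dominates : ∀ {S} → SteinerSet G I S → 2 ≤ ∣ I ∣ →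
                        ∀ {x} → x ∈ I → ∃[ u ] u ∈ S × x ∈ M u
    Steiner-dominates {S} steiner 2≤∣I∣ {x} x∈I = case-other (other (2≤∣p∣⇒Two 2≤∣I∣))
      where
      other : Two I → ∃[ y ] x ≢ y × y ∈ I
      other (y , z , y≢z , y∈I , z∈I) with x ≟ y
      ... | no  x≢y  = y , x≢y , y∈I
      ... | yes refl = z , y≢z , z∈I

      first-step : ∀ {y} → x ≢ y → Star (AdjIn G (S ∪ I)) x y → ∃[ u ] u ∈ S × x ∈ M u
      first-step x≢y ε = contradiction refl x≢y
      first-step x≢y (_◅_ {j = u} (_ , u∈ , x~u) _) with x∈p∪q⁻ S I u∈
      ... | inj₁ u∈S = u , u∈S , x∈p∩q⁺ (∈N⁺ G (adj-sym x~u) , x∈I)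
      ... | inj₂ u∈I = contradiction x~u (independent x u x∈I u∈I)

      case-other : ∃[ y ] x ≢ y × y ∈ I → ∃[ u ] u ∈ S × x ∈ M u
      case-other (y , x≢y , y∈I) = first-step x≢y
        (SteinerSet.connected steiner x y (q⊆p∪q S I x∈I) (q⊆p∪q S I y∈I))

  -- Greedy covering

  -- U is the part covered by the vertices already picked, T the vertices left.
  Covers : (U T : Subset n) → Set
  Covers U T = ∀ {x} → x ∈ I → x ∈ U ⊎ ∃[ u ] u ∈ T × x ∈ M u

  -- The threshold is two new elements, since a vertex covering at most one is paid for by its own
  -- place in `T`.
  Petal : Subset n → Fin n → Set
  Petal U v = Two (M v ∩ ∁ U)

  -- If no vertex of `T` covers two elements of `I` outside `U`, then sending each such element to a
  -- vertex of `T` covering it is injective.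
  greedy-step : ∀ {U T} → Covers U T → ∣ I ∣ ≤ ∣ U ∣ + ∣ T ∣ ⊎ ∃[ v ] v ∈ T × Petal U v
  greedy-step {U} {T} cov with any? (λ v → v ∈? T ×-dec 2 ≤? ∣ M v ∩ ∁ U ∣)
  ... | yes (v , v∈T , 2≤) = inj₂ (v , v∈T , 2≤∣p∣⇒Two 2≤)
  ... | no  none = inj₁ (begin
    ∣ I ∣                   ≤⟨ ∣p∣≤∣p∪q∣ I U ⟩
    ∣ I ∪ U ∣               ≤⟨ ∣p∪q∣≤∣p∩∁q∣+∣q∣ I U ⟩
    ∣ I ∩ ∁ U ∣ + ∣ U ∣     ≤⟨ +-monoˡ-≤ ∣ U ∣ (matching⇒∣p∣≤∣q∣ (λ x u → x ∈ M u) total unique) ⟩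
    ∣ T ∣ + ∣ U ∣           ≡⟨ +-comm ∣ T ∣ ∣ U ∣ ⟩
    ∣ U ∣ + ∣ T ∣           ∎)
    where
    open ≤-Reasoning

    total : ∀ {x} → x ∈ I ∩ ∁ U → ∃[ u ] u ∈ T × x ∈ M u
    total x∈ with x∈p∩q⁻ I (∁ U) x∈
    ... | x∈I , x∈∁U with cov x∈I
    ...   | inj₁ x∈U = contradiction x∈U (x∈∁p⇒x∉p x∈∁U)
    ...   | inj₂ u   = u

    unique : ∀ {x y u} → x ∈ I ∩ ∁ U → y ∈ I ∩ ∁ U → u ∈ T → x ∈ M u → y ∈ M u → x ≡ y
    unique {x} {y} x∈ y∈ u∈T x∈M y∈M = decidable-stable (x ≟ y) λ x≢y →
      none (_ , u∈T , unique⇒length≤∣p∣ ((x≢y ∷ []) ∷ [] ∷ [])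
        (x∈p∩q⁺ (x∈M , proj₂ (x∈p∩q⁻ I (∁ U) x∈)) ∷
         x∈p∩q⁺ (y∈M , proj₂ (x∈p∩q⁻ I (∁ U) y∈)) ∷ []))

  pick : ∀ {U T} v → Covers U T → Covers (M v ∪ U) (T - v)
  pick v cov x∈I with cov x∈I
  ... | inj₁ x∈U = inj₁ (x∈p∪q⁺ (inj₂ x∈U))
  ... | inj₂ (u , u∈T , x∈M) with u ≟ v
  ...   | yes refl = inj₁ (x∈p∪q⁺ (inj₁ x∈M))
  ...   | no  u≢v  = inj₂ (u , x∈p∧x≢y⇒x∈p-y u∈T u≢v , x∈M)

  -- Counting picks in a `K₁,₄`-free 3-split graph

  module _ (lsplit : IsLSplit G 3 I C) (free : (K₁, 4) -free G) where
    open IsLSplit lsplit renaming (isSplit to split)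

    ∣M∣≤3 : ∀ {v} → v ∈ C → ∣ M v ∣ ≤ 3
    ∣M∣≤3 v∈C = subst (_ ≤_) Δᴵ≡l (Δᴵ-bound v∈C)

    -- The case `v ≡ u` is included so that picks need not be shown distinct; there any element of
    -- `M v` serves.
    triple-meets : ∀ {v u} → v ∈ C → u ∈ C → 3 ≤ ∣ M v ∣ → ∃[ x ] x ∈ M v × x ∈ M u
    triple-meets {v} {u} v∈C u∈C 3≤ with v ≟ u
    ... | no  v≢u  = large-meets split free v∈C u∈C 3≤ v≢u
    ... | yes refl with k≤∣p∣⇒injection 3≤
    ...   | f , _ , f∈M = f zero , f∈M zero , f∈M zero

    -- Since `e` is already covered, picking `v` adds at most two elements to `U`, while `T` loses a
    -- vertex.
    pick-cost : ∀ {U T v e} → v ∈ C → v ∈ T → e ∈ M v → e ∈ U →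
                ∣ M v ∪ U ∣ + ∣ T - v ∣ ≤ suc (∣ U ∣ + ∣ T ∣)
    pick-cost {U} {T} {v} {e} v∈C v∈T e∈M e∈U = s≤s⁻¹ (begin
      suc (∣ M v ∪ U ∣ + ∣ T - v ∣)   ≡⟨ sym (+-suc _ _) ⟩
      ∣ M v ∪ U ∣ + suc ∣ T - v ∣     ≤⟨ +-mono-≤ new (x∈p⇒∣p-x∣<∣p∣ v∈T) ⟩
      2 + ∣ U ∣ + ∣ T ∣               ∎)
      where
      open ≤-Reasoning

      new⊆M-e : ∀ {x} → x ∈ M v ∩ ∁ U → x ∈ M v - e
      new⊆M-e x∈ with x∈p∩q⁻ (M v) (∁ U) x∈
      ... | x∈M , x∈∁U = x∈p∧x≢y⇒x∈p-y x∈M λ { refl → x∈∁p⇒x∉p x∈∁U e∈U }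

      1+new≤3 : suc ∣ M v ∩ ∁ U ∣ ≤ 3
      1+new≤3 = ≤-trans (s≤s (p⊆q⇒∣p∣≤∣q∣ new⊆M-e))
        (≤-trans (x∈p⇒∣p-x∣<∣p∣ e∈M) (∣M∣≤3 v∈C))

      new : ∣ M v ∪ U ∣ ≤ 2 + ∣ U ∣
      new = ≤-trans (∣p∪q∣≤∣p∩∁q∣+∣q∣ (M v) U)
        (+-monoˡ-≤ ∣ U ∣ (s≤s⁻¹ 1+new≤3))

    petal-triple : ∀ {U v e} → Petal U v → e ∈ M v → e ∈ U → 3 ≤ ∣ M v ∣
    petal-triple {U} {v} (x , y , x≢y , x∈ , y∈) e∈M e∈U =
      let x∈M , x∈∁U = x∈p∩q⁻ (M v) (∁ U) x∈
          y∈M , y∈∁U = x∈p∩q⁻ (M v) (∁ U) y∈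
      in unique⇒length≤∣p∣
        (((λ { refl → x∈∁p⇒x∉p x∈∁U e∈U }) ∷ (λ { refl → x∈∁p⇒x∉p y∈∁U e∈U }) ∷ []) ∷
         (x≢y ∷ []) ∷ [] ∷ [])
        (e∈M ∷ x∈M ∷ y∈M ∷ [])

    -- Two of the at most three elements of `M v` lie outside `U`, which leaves room for only one
    -- inside. This turns pairwise meetings into a common core.
    petal-core-unique : ∀ {U v e e′} → v ∈ C → Petal U v →
                        e ∈ M v → e ∈ U → e′ ∈ M v → e′ ∈ U → e ≡ e′
    petal-core-unique {U} {v} {e} {e′} v∈C (x , y , x≢y , x∈ , y∈) e∈M e∈U e′∈M e′∈U =
      decidable-stable (e ≟ e′) λ e≢e′ →
      let x∈M , x∈∁U = x∈p∩q⁻ (M v) (∁ U) x∈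
          y∈M , y∈∁U = x∈p∩q⁻ (M v) (∁ U) y∈
      in 1+n≰n (≤-trans (unique⇒length≤∣p∣
        ((e≢e′ ∷ (λ { refl → x∈∁p⇒x∉p x∈∁U e∈U }) ∷ (λ { refl → x∈∁p⇒x∉p y∈∁U e∈U }) ∷ []) ∷
         ((λ { refl → x∈∁p⇒x∉p x∈∁U e′∈U }) ∷ (λ { refl → x∈∁p⇒x∉p y∈∁U e′∈U }) ∷ []) ∷
         (x≢y ∷ []) ∷ [] ∷ [])
        (e∈M ∷ e′∈M ∷ x∈M ∷ y∈M ∷ [])) (∣M∣≤3 v∈C))

    no-four-petals : ∀ {v₁ v₂ v₃ v₄} → v₁ ∈ C → v₂ ∈ C → v₃ ∈ C → v₄ ∈ C →
                     3 ≤ ∣ M v₁ ∣ → Petal (M v₁) v₂ → Petal (M v₂ ∪ M v₁) v₃ →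
                     ¬ Petal (M v₃ ∪ (M v₂ ∪ M v₁)) v₄
    no-four-petals {v₁} {v₂} {v₃} {v₄} c₁ c₂ c₃ c₄ t₁ π₂ π₃ π₄
      with triple-meets c₁ c₂ t₁ | triple-meets c₁ c₃ t₁ | triple-meets c₁ c₄ t₁
    ... | e , e∈₁ , e∈₂ | a , a∈₁ , a∈₃ | b , b∈₁ , b∈₄
      -- `M v₂` has two new elements besides `e`, so it is a triple and in turn meets `M v₃` and
      -- `M v₄`.
      with triple-meets c₂ c₃ t₂ | triple-meets c₂ c₄ t₂
      where
      t₂ = petal-triple π₂ e∈₂ e∈₁
    ... | a′ , a′∈₂ , a′∈₃ | b′ , b′∈₂ , b′∈₄
      -- `a` and `a′` are both already covered elements of `M v₃`, hence equal; likewise `b` and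
      -- `b′` in `M v₄`.
      with petal-core-unique c₃ π₃ a∈₃ (x∈p∪q⁺ (inj₂ a∈₁)) a′∈₃ (x∈p∪q⁺ (inj₁ a′∈₂))
         | petal-core-unique c₄ π₄ b∈₄ (x∈p∪q⁺ (inj₂ (x∈p∪q⁺ (inj₂ b∈₁))))
                             b′∈₄ (x∈p∪q⁺ (inj₂ (x∈p∪q⁺ (inj₁ b′∈₂))))
    ... | refl | refl
      -- Both remaining elements lie in `M v₁` and `M v₂`, so they coincide: all four sets share
      -- `a`.
      with petal-core-unique c₂ π₂ a′∈₂ a∈₁ b′∈₂ b∈₁
         | nonneighbour split (proj₂ (x∈p∩q⁻ (N G v₁) I a∈₁))
    ... | refl | w , w∈C , w≁a
      with triple-meets c₁ w∈C t₁
         | triple-meets c₂ w∈C (petal-triple π₂ a′∈₂ a∈₁)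
         | triple-meets c₃ w∈C (petal-triple π₃ a∈₃ (x∈p∪q⁺ (inj₂ a∈₁)))
         | triple-meets c₄ w∈C (petal-triple π₄ b∈₄ (x∈p∪q⁺ (inj₁ a∈₃)))
    ... | f₁ , f₁∈ , f₁∈w | f₂ , f₂∈ , f₂∈w | f₃ , f₃∈ , f₃∈w | f₄ , f₄∈ , f₄∈w =
      -- `f₂`, `f₃` and `f₄` each lie outside the earlier sets, so `M w` has four distinct elements.
      1+n≰n (≤-trans (unique⇒length≤∣p∣
        (((λ { refl → f₂∉ f₁∈ }) ∷ (λ { refl → f₃∉ (x∈p∪q⁺ (inj₂ f₁∈)) }) ∷
          (λ { refl → f₄∉ (x∈p∪q⁺ (inj₂ (x∈p∪q⁺ (inj₂ f₁∈)))) }) ∷ []) ∷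
         ((λ { refl → f₃∉ (x∈p∪q⁺ (inj₁ f₂∈)) }) ∷
          (λ { refl → f₄∉ (x∈p∪q⁺ (inj₂ (x∈p∪q⁺ (inj₁ f₂∈)))) }) ∷ []) ∷
         ((λ { refl → f₄∉ (x∈p∪q⁺ (inj₁ f₃∈)) }) ∷ []) ∷ [] ∷ [])
        (f₁∈w ∷ f₂∈w ∷ f₃∈w ∷ f₄∈w ∷ [])) (∣M∣≤3 w∈C))
      where
      -- An element of `M v` in `U` must be the core `a`, which `M w` misses.
      avoids : ∀ {U v f} → v ∈ C → Petal U v → a ∈ M v → a ∈ U → f ∈ M v → f ∈ M w → f ∉ U
      avoids v∈C π a∈M a∈U f∈M f∈w f∈U with petal-core-unique v∈C π a∈M a∈U f∈M f∈U
      ... | refl = w≁a (∈N⁻ G (proj₁ (x∈p∩q⁻ (N G w) I f∈w)))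

      f₂∉ = avoids c₂ π₂ a′∈₂ a∈₁ f₂∈ f₂∈w
      f₃∉ = avoids c₃ π₃ a∈₃ (x∈p∪q⁺ (inj₂ a∈₁)) f₃∈ f₃∈w
      f₄∉ = avoids c₄ π₄ b∈₄ (x∈p∪q⁺ (inj₁ a∈₃)) f₄∈ f₄∈w

    cover-bound-with-triple : ∀ {S v₁} → (∀ {u} → u ∈ S → u ∈ C) →
                              (∀ {x} → x ∈ I → ∃[ u ] u ∈ S × x ∈ M u) →
                              v₁ ∈ S → 3 ≤ ∣ M v₁ ∣ → ∣ I ∣ ≤ 4 + ∣ S ∣
    cover-bound-with-triple {S} {v₁} S⊆C dom v₁∈S t₁ = bound
      where
      c₁ = S⊆C v₁∈S

      T₁ = S - v₁

      T₁⊆C : ∀ {u} → u ∈ T₁ → u ∈ C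
      T₁⊆C u∈ = S⊆C (p─q⊆p S ⁅ v₁ ⁆ u∈)

      cov₁ : Covers (M v₁) T₁
      cov₁ x∈I with dom x∈I
      ... | u , u∈S , x∈M with u ≟ v₁
      ...   | yes refl = inj₁ x∈M
      ...   | no  u≢v  = inj₂ (u , x∈p∧x≢y⇒x∈p-y u∈S u≢v , x∈M)

      -- The surplus 2 is at most three covered elements minus the one vertex taken from `S`.
      cost₁ : ∣ M v₁ ∣ + ∣ T₁ ∣ ≤ 2 + ∣ S ∣
      cost₁ = s≤s⁻¹ (≤-trans (≤-reflexive (sym (+-suc _ _)))
        (+-mono-≤ (∣M∣≤3 c₁) (x∈p⇒∣p-x∣<∣p∣ v₁∈S)))

      bound : ∣ I ∣ ≤ 4 + ∣ S ∣
      bound with greedy-step cov₁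
      ... | inj₁ done = ≤-trans done (m≤n⇒m≤1+n (m≤n⇒m≤1+n cost₁))
      ... | inj₂ (v₂ , v₂∈T , π₂) = second (greedy-step cov₂)
        where
        c₂ = T₁⊆C v₂∈T

        T₂ = T₁ - v₂

        cov₂ = pick v₂ cov₁

        cost₂ : ∣ M v₂ ∪ M v₁ ∣ + ∣ T₂ ∣ ≤ 3 + ∣ S ∣
        cost₂ with triple-meets c₁ c₂ t₁
        ... | e , e∈₁ , e∈₂ = ≤-trans (pick-cost c₂ v₂∈T e∈₂ e∈₁) (s≤s cost₁)

        second : _ → ∣ I ∣ ≤ 4 + ∣ S ∣
        second (inj₁ done) = ≤-trans done (m≤n⇒m≤1+n cost₂)
        second (inj₂ (v₃ , v₃∈T , π₃)) = third (greedy-step (pick v₃ cov₂))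
          where
          c₃ = T₁⊆C (p─q⊆p T₁ ⁅ v₂ ⁆ v₃∈T)

          third : _ → ∣ I ∣ ≤ 4 + ∣ S ∣
          third (inj₁ done) with triple-meets c₁ c₃ t₁
          ... | a , a∈₁ , a∈₃ = ≤-trans done
            (≤-trans (pick-cost c₃ v₃∈T a∈₃ (x∈p∪q⁺ (inj₂ a∈₁))) (s≤s cost₂))
          -- Three picks use up the whole allowance `4 + ∣ S ∣`, so a fourth must be excluded.
          third (inj₂ (v₄ , v₄∈T , π₄)) = ⊥-elim (no-four-petals c₁ c₂ c₃
            (T₁⊆C (p─q⊆p T₁ ⁅ v₂ ⁆ (p─q⊆p T₂ ⁅ v₃ ⁆ v₄∈T))) t₁ π₂ π₃ π₄)

    cover-bound : ∀ {S} → (∀ {u} → u ∈ S → u ∈ C) →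
                  (∀ {x} → x ∈ I → ∃[ u ] u ∈ S × x ∈ M u) → ∣ I ∣ ≤ 4 + ∣ S ∣
    cover-bound {S} S⊆C dom with any? (λ v → v ∈? S ×-dec 3 ≤? ∣ M v ∣)
    ... | yes (v , v∈S , 3≤) = cover-bound-with-triple S⊆C dom v∈S 3≤
    ... | no  none with Δᴵ-attained Δᴵ≡l
    -- This `v` is outside `S`, so `T` is all of `S`.
    ... | v , v∈C , ∣M∣≡3 with greedy-step {U = M v} (inj₂ ∘ dom)
    ... | inj₁ done = ≤-trans done (+-monoˡ-≤ ∣ S ∣ (m≤n⇒m≤1+n (∣M∣≤3 v∈C)))
    -- A petal `u` would share an element with the triple `M v`, making `M u` a triple although `u`
    -- is in `S`.
    ... | inj₂ (u , u∈S , π) with triple-meets v∈C (S⊆C u∈S) (≤-reflexive (sym ∣M∣≡3))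
    ... | e , e∈v , e∈u = ⊥-elim (none (u , u∈S , petal-triple π e∈u e∈v))

    -- A vertex attaining `Δᴵ` already has three neighbours in `I`.
    2≤∣I∣ : 2 ≤ ∣ I ∣
    2≤∣I∣ with Δᴵ-attained Δᴵ≡l
    ... | v , _ , ∣M∣≡3 = ≤-trans (s≤s (s≤s z≤n)) (≤-trans (≤-reflexive (sym ∣M∣≡3))
      (p⊆q⇒∣p∣≤∣q∣ (proj₂ ∘ x∈p∩q⁻ (N G v) I)))

theorem2 : ∀ {n : ℕ} (G : Graph n) (I C : Subset n)
    → IsLSplit G 3 I C
    → Connected G
    → (K₁, 4) -free G
    → ∀ (S : Subset n) → MinimumSteinerSet G I S
    → ∣ S ∣ ≥ ∣ I ∣ ∸ 4
theorem2 G I C lsplit _ free S min = m≤n+o⇒m∸n≤o ∣ I ∣ 4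
  (cover-bound G I C lsplit free
    (Steiner⊆C G I C split steiner)
    (Steiner-dominates G I C split steiner (2≤∣I∣ G I C lsplit free)))
  where
  open MinimumSteinerSet min using (steiner)
  open IsLSplit lsplit renaming (isSplit to split)
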